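{- Let $k$ and $l'$ be positive integers with $l'<k$. If $\mathcal{F} \subseteq 2^{[n]}$ is an $(n-l')$-trace $k$-Sperner family, then $|\mathcal{F}| \le (k-l'+o(1))\binom{n}{\lfloor n/2\rfloor}$, where the $o(1)$ term tends to $0$ as $n\to\infty$ with $k$ and $l'$ fixed.
   Context: $[n]=\{1,\dots,n\}$ and $2^{[n]}$ is the family of all subsets of $[n]$. A chain of length $m$ is a sequence of sets $F_1\subsetneq F_2\subsetneq\dots\subsetneq F_m$. A family is $k$-Sperner if it contains no chain of length $k+1$. For a family $\mathcal{F}$ and a set $X$, the trace is $\mathcal{F}|_X=\{F\cap X: F\in\mathcal{F}\}$. A family $\mathcal{F}\subseteq 2^{[n]}$ is $l$-trace $k$-Sperner if for every $l$-element subset $L\subseteq[n]$ the family $\mathcal{F}|_L$ is $k$-Sperner. -}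

module Defs where

open import Data.Nat using (ℕ; suc)
open import Data.Product using (∃; _×_)
open import Data.List using (List; map; length)
open import Data.List.Membership.Propositional using (_∈_)
open import Data.List.Relation.Unary.All using (All)
open import Data.List.Relation.Unary.Linked using (Linked)
open import Data.Fin.Subset using (Subset; _∩_; _⊂_; ∣_∣)
open import Relation.Binary.PropositionalEquality using (_≡_)
open import Relation.Nullary using (¬_)

-- A family of subsets of [n] is a duplicate-free list of subsets
-- (duplicate-freeness is imposed in the statement via Unique);
-- its size is its length.

IsChain : ∀ {n} → ℕ → List (Subset n) → Set
IsChain m cs = length cs ≡ m × Linked _⊂_ cs

KSperner : ∀ {n} → ℕ → List (Subset n) → Set
KSperner k 𝒢 = ¬ ∃ λ cs → IsChain (suc k) cs × All (λ G → G ∈ 𝒢) cs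

trace : ∀ {n} → List (Subset n) → Subset n → List (Subset n)
trace 𝓕 L = map (λ F → F ∩ L) 𝓕

TraceSperner : ∀ {n} → ℕ → ℕ → List (Subset n) → Set
TraceSperner {n} l k 𝓕 = ∀ (L : Subset n) → ∣ L ∣ ≡ l → KSperner k (trace 𝓕 L)

module Submission where

-- Let f(k,l) be the largest size, relative to C(n,⌊n/2⌋), of an (n-l)-trace k-Sperner family. Split 𝓕 along one
-- element x of the ground set: |𝓕| is the size of the trace of 𝓕 off x plus the number of pairs {A, A∪{x}} in 𝓕.
-- The trace is (l-1, k) on n-1 points; the family of pairs is (l, k-1) there, since the top of a chain of pairs can
-- be prolonged by x. As C(n,⌊n/2⌋) ≈ 2C(n-1,⌊(n-1)/2⌋), this gives f(k,l) ≤ (f(k,l-1) + f(k-1,l))/2, so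
-- f(k,l) ≤ k-l follows from two boundary cases. For l = 0 it is Erdős's theorem, proved by a symmetric chain
-- decomposition. For l = k one needs |𝓕| = o(C(n,⌊n/2⌋)): a walk A₀, …, Aₖ in 𝓕 with Aᵢ = Aᵢ₋₁ - xᵢ + yᵢ and all
-- xᵢ, yᵢ distinct is a chain of length k+1 off {x₁,…,xₖ}, and a double count shows that only O(2ⁿ/n) sets of a family
-- admit no swap x, y avoiding some prescribed bounded set of elements.

open import Defs
open import Data.Bool using (Bool; true; false; T; _∨_; _∧_; not) renaming (_≟_ to _≟ᵇ_)
open import Data.Bool.Properties using (T?; T-∧; T-∨; ¬-not; not-¬; not-involutive)
open import Data.Fin using (Fin; zero; suc)
import Data.Fin.Properties as Fin
open import Data.Fin.Subset using (Subset; inside; outside; _∈_; _∉_; _⊆_; _⊂_; _⊃_; _∩_; _∪_; ∁; ⊥; ⁅_⁆; ∣_∣; Nonempty)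
open import Data.Fin.Subset.Properties
open import Data.List using (List; []; _∷_; _++_; map; length; concatMap)
import Data.List.Membership.DecPropositional
open import Data.List.Membership.Propositional using () renaming (_∈_ to _∈ₗ_)
open import Data.List.Membership.Propositional.Properties using (∈-map⁺)
open import Data.List.NonEmpty using (List⁺; _∷_; toList)
open import Data.List.Properties using (map-++; length-map; map-∘)
open import Data.List.Relation.Unary.All as All using (All; []; _∷_)
import Data.List.Relation.Unary.All.Properties as All
open import Data.List.Relation.Unary.AllPairs using (AllPairs; []; _∷_)
open import Data.List.Relation.Unary.Any using (here; there)
open import Data.List.Relation.Unary.Linked as Linked using (Linked; [-]; _∷_)
import Data.List.Relation.Unary.Linked.Properties as Linked
open import Data.List.Relation.Unary.Unique.Propositional using (Unique)
open import Data.Nat using (ℕ; zero; suc; _+_; _*_; _∸_; _^_; _/_;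
  _≤_; _<_; _≤?_; _<?_; _≡ᵇ_; z≤n; s≤s; s≤s⁻¹; NonZero; >-nonZero)
open import Data.Nat.Combinatorics using (_C_; nC1≡n; nCn≡1; nCk≡nC[n∸k]; nCk+nC[k+1]≡[n+1]C[k+1])
open import Data.Nat.Divisibility using (n∣m*n)
open import Data.Nat.DivMod using (m*n/n≡m; m/n*n≤m; m≡m%n+[m/n]*n; m%n<n; +-distrib-/-∣ʳ)
import Data.Nat.ListAction as List
open import Data.Nat.ListAction.Properties using (sum-++)
open import Data.Nat.Properties
open import Algebra.Properties.CommutativeMonoid.Sum +-0-commutativeMonoid using (sum; sum-cong-≗; ∑-distrib-+)
open import Data.Nat.Tactic.RingSolver using (solve-∀)
open import Data.Product using (∃; _×_; _,_; proj₁; proj₂)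
open import Data.Sum using (_⊎_; inj₁; inj₂; [_,_]′)
open import Data.Vec using ([]; _∷_; lookup; tabulate; updateAt; here; there)
open import Data.Vec.Properties using ([]=⇒lookup; lookup⇒[]=; lookup∘tabulate; ≡-dec;
  updateAt-updateAt; updateAt-id-local; updateAt-commutes; updateAt-minimal;
  lookup∘updateAt; lookup∘updateAt′)
open import Function using (_∘_; Equivalence)
open import Level using (0ℓ)
open import Relation.Binary using (Rel)
open import Relation.Binary.PropositionalEquality
open import Relation.Nullary using (¬_; Dec; yes; no; ⌊_⌋; contradiction; _×-dec_; _→-dec_; ¬?; toWitness; fromWitness)

private variable
  m n : ℕ

-- Central binomial coefficients

-- Absorption identity, by induction through Pascal's rule; it yields the ratios of consecutive
-- central coefficients.
[1+k]*[1+n]C[1+k]≡[1+n]*nCk : ∀ n k → suc k * (suc n C suc k) ≡ suc n * (n C k)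
[1+k]*[1+n]C[1+k]≡[1+n]*nCk n zero = trans (*-identityˡ _) (trans (nC1≡n (suc n)) (sym (*-identityʳ (suc n))))
[1+k]*[1+n]C[1+k]≡[1+n]*nCk zero (suc k) = *-zeroʳ (2 + k)
[1+k]*[1+n]C[1+k]≡[1+n]*nCk (suc n) (suc k) = begin
  (2 + k) * (suc (suc n) C suc (suc k))
    ≡⟨ cong ((2 + k) *_) (nCk+nC[k+1]≡[n+1]C[k+1] (suc n) (suc k)) ⟨
  (2 + k) * (a + b)
    ≡⟨ split k a b ⟩
  (1 + k) * a + (2 + k) * b + a
    ≡⟨ cong (_+ a) (cong₂ _+_ ([1+k]*[1+n]C[1+k]≡[1+n]*nCk n k) ([1+k]*[1+n]C[1+k]≡[1+n]*nCk n (suc k))) ⟩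
  suc n * (n C k) + suc n * (n C suc k) + a
    ≡⟨ cong (_+ a) (*-distribˡ-+ (suc n) (n C k) (n C suc k)) ⟨
  suc n * (n C k + n C suc k) + a
    ≡⟨ cong (λ c → suc n * c + a) (nCk+nC[k+1]≡[n+1]C[k+1] n k) ⟩
  suc n * a + a
    ≡⟨ +-comm (suc n * a) a ⟩
  (2 + n) * a ∎
  where
  open ≡-Reasoning
  a = suc n C suc k
  b = suc n C suc (suc k)
  split : ∀ k a b → (2 + k) * (a + b) ≡ (1 + k) * a + (2 + k) * b + a
  split = solve-∀

central : ℕ → ℕ
central n = n C (n / 2)

even-or-odd : ∀ n → ∃ λ p → n ≡ p * 2 ⊎ n ≡ suc (p * 2)
even-or-odd zero = 0 , inj₁ refl
even-or-odd (suc n) with even-or-odd n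
... | p , inj₁ n≡2p = p , inj₂ (cong suc n≡2p)
... | p , inj₂ n≡1+2p = suc p , inj₁ (cong suc n≡1+2p)

[1+2p]/2≡p : ∀ p → suc (p * 2) / 2 ≡ p
[1+2p]/2≡p p = trans (+-distrib-/-∣ʳ 1 {p * 2} {2} (n∣m*n p)) (m*n/n≡m p 2)

central-even : ∀ p → central (p * 2) ≡ (p * 2) C p
central-even p = cong ((p * 2) C_) (m*n/n≡m p 2)

central-odd : ∀ p → central (suc (p * 2)) ≡ suc (p * 2) C p
central-odd p = cong (suc (p * 2) C_) ([1+2p]/2≡p p)

p*2≡p+p : ∀ p → p * 2 ≡ p + p
p*2≡p+p = solve-∀

p≤2p : ∀ p → p ≤ p * 2
p≤2p p = m≤m*n p 2

[1+2p]C[1+p]≡[1+2p]Cp : ∀ p → suc (p * 2) C suc p ≡ suc (p * 2) C p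
[1+2p]C[1+p]≡[1+2p]Cp p = trans (nCk≡nC[n∸k] (s≤s (p≤2p p)))
  (cong (suc (p * 2) C_) (trans (cong (_∸ p) (p*2≡p+p p)) (m+n∸n≡m p p)))

central-odd-suc : ∀ p → central (suc p * 2) ≡ 2 * central (suc (p * 2))
central-odd-suc p = begin
  central (suc p * 2)                                ≡⟨ central-even (suc p) ⟩
  suc (suc (p * 2)) C suc p                          ≡⟨ nCk+nC[k+1]≡[n+1]C[k+1] (suc (p * 2)) p ⟨
  suc (p * 2) C p + suc (p * 2) C suc p              ≡⟨ cong (suc (p * 2) C p +_) ([1+2p]C[1+p]≡[1+2p]Cp p) ⟩
  suc (p * 2) C p + suc (p * 2) C p                  ≡⟨ cong₂ _+_ (central-odd p) (central-odd p) ⟨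
  central (suc (p * 2)) + central (suc (p * 2))      ≡⟨ cong (central (suc (p * 2)) +_) (+-identityʳ _) ⟨
  2 * central (suc (p * 2))                          ∎
  where open ≡-Reasoning

central-even-suc : ∀ p → suc p * central (suc (p * 2)) ≡ suc (p * 2) * central (p * 2)
central-even-suc p = begin
  suc p * central (suc (p * 2))       ≡⟨ cong (suc p *_) (trans (central-odd p) (sym ([1+2p]C[1+p]≡[1+2p]Cp p))) ⟩
  suc p * (suc (p * 2) C suc p)       ≡⟨ [1+k]*[1+n]C[1+k]≡[1+n]*nCk (p * 2) p ⟩
  suc (p * 2) * ((p * 2) C p)         ≡⟨ cong (suc (p * 2) *_) (central-even p) ⟨
  suc (p * 2) * central (p * 2)       ∎
  where open ≡-Reasoning

-- The ratio of `central (suc n)` to `central n` is exactly 2(n+1)/(n+2) for even n and exactly 2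
-- for odd n.
2*[1+n]*central≤[2+n]*central : ∀ n → 2 * (suc n * central n) ≤ suc (suc n) * central (suc n)
2*[1+n]*central≤[2+n]*central n with even-or-odd n
... | p , inj₁ refl = ≤-reflexive (begin
  2 * (suc (p * 2) * central (p * 2))       ≡⟨ cong (2 *_) (central-even-suc p) ⟨
  2 * (suc p * central (suc (p * 2)))       ≡⟨ regroup p (central (suc (p * 2))) ⟩
  suc (suc (p * 2)) * central (suc (p * 2)) ∎)
  where
  open ≡-Reasoning
  regroup : ∀ p c → 2 * (suc p * c) ≡ suc (suc (p * 2)) * c
  regroup = solve-∀
... | p , inj₂ refl = begin
  2 * (suc (suc (p * 2)) * c)                ≡⟨ regroup (suc (suc (p * 2))) c ⟩
  suc (suc (p * 2)) * (2 * c)                ≤⟨ *-monoˡ-≤ (2 * c) (n≤1+n (suc (suc (p * 2)))) ⟩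
  suc (suc (suc (p * 2))) * (2 * c)          ≡⟨ cong (suc (suc (suc (p * 2))) *_) (central-odd-suc p) ⟨
  suc (suc (suc (p * 2))) * central (suc (suc (p * 2))) ∎
  where
  open ≤-Reasoning
  c = central (suc (p * 2))
  regroup : ∀ m c → 2 * (m * c) ≡ m * (2 * c)
  regroup = solve-∀

-- Wallis-type bound. The factor 4p+1 makes the induction close: 4(4p+5)(2p+1)² exceeds
-- 16(4p+1)(p+1)² by exactly 4.
16^p≤[4p+1]*central² : ∀ p → 16 ^ p ≤ (4 * p + 1) * (central (p * 2) * central (p * 2))
16^p≤[4p+1]*central² zero = ≤-refl
16^p≤[4p+1]*central² (suc p) = *-cancelˡ-≤ (suc p * suc p) (begin
  (suc p * suc p) * (16 * 16 ^ p)
    ≤⟨ *-monoʳ-≤ (suc p * suc p) (*-monoʳ-≤ 16 (16^p≤[4p+1]*central² p)) ⟩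
  (suc p * suc p) * (16 * ((4 * p + 1) * (c * c)))         ≤⟨ m≤m+n _ (4 * (c * c)) ⟩
  (suc p * suc p) * (16 * ((4 * p + 1) * (c * c))) + 4 * (c * c)
    ≡⟨ expand p c ⟩
  4 * (4 * suc p + 1) * ((suc (p * 2) * c) * (suc (p * 2) * c))
    ≡⟨ cong (λ x → 4 * (4 * suc p + 1) * (x * x)) (central-even-suc p) ⟨
  4 * (4 * suc p + 1) * ((suc p * c′) * (suc p * c′))
    ≡⟨ regroup p c′ ⟩
  (suc p * suc p) * ((4 * suc p + 1) * ((2 * c′) * (2 * c′)))
    ≡⟨ cong (λ x → (suc p * suc p) * ((4 * suc p + 1) * (x * x))) (central-odd-suc p) ⟨
  (suc p * suc p) * ((4 * suc p + 1) * (central (suc p * 2) * central (suc p * 2))) ∎)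
  where
  open ≤-Reasoning
  c = central (p * 2)
  c′ = central (suc (p * 2))
  expand : ∀ p c → (suc p * suc p) * (16 * ((4 * p + 1) * (c * c))) + 4 * (c * c)
                 ≡ 4 * (4 * suc p + 1) * ((suc (p * 2) * c) * (suc (p * 2) * c))
  expand = solve-∀
  regroup : ∀ p c → 4 * (4 * suc p + 1) * ((suc p * c) * (suc p * c))
                  ≡ (suc p * suc p) * ((4 * suc p + 1) * ((2 * c) * (2 * c)))
  regroup = solve-∀

2^2p*2^2p≡16^p : ∀ p → 2 ^ (p * 2) * 2 ^ (p * 2) ≡ 16 ^ p
2^2p*2^2p≡16^p p = begin
  2 ^ (p * 2) * 2 ^ (p * 2)   ≡⟨ ^-distribˡ-+-* 2 (p * 2) (p * 2) ⟨
  2 ^ (p * 2 + p * 2)         ≡⟨ cong (2 ^_) (2p+2p≡4p p) ⟩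
  2 ^ (4 * p)                 ≡⟨ ^-*-assoc 2 4 p ⟨
  16 ^ p                      ∎
  where
  open ≡-Reasoning
  2p+2p≡4p : ∀ p → p * 2 + p * 2 ≡ 4 * p
  2p+2p≡4p = solve-∀

2^n*2^n≤4*[2n+1]*central² : ∀ n → 2 ^ n * 2 ^ n ≤ 4 * (2 * n + 1) * (central n * central n)
2^n*2^n≤4*[2n+1]*central² n with even-or-odd n
... | p , inj₁ refl = begin
  2 ^ (p * 2) * 2 ^ (p * 2)                     ≡⟨ 2^2p*2^2p≡16^p p ⟩
  16 ^ p                                        ≤⟨ 16^p≤[4p+1]*central² p ⟩
  (4 * p + 1) * (c * c)                         ≤⟨ *-monoˡ-≤ (c * c) (m≤m+n (4 * p + 1) (3 * (4 * p + 1))) ⟩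
  (4 * p + 1 + 3 * (4 * p + 1)) * (c * c)       ≡⟨ regroup p (c * c) ⟩
  4 * (2 * (p * 2) + 1) * (c * c)               ∎
  where
  open ≤-Reasoning
  c = central (p * 2)
  regroup : ∀ p d → (4 * p + 1 + 3 * (4 * p + 1)) * d ≡ 4 * (2 * (p * 2) + 1) * d
  regroup = solve-∀
... | p , inj₂ refl = begin
  2 * 2 ^ (p * 2) * (2 * 2 ^ (p * 2))           ≡⟨ regroup₁ (2 ^ (p * 2)) ⟩
  4 * (2 ^ (p * 2) * 2 ^ (p * 2))               ≡⟨ cong (4 *_) (2^2p*2^2p≡16^p p) ⟩
  4 * 16 ^ p                                    ≤⟨ *-monoʳ-≤ 4 (16^p≤[4p+1]*central² p) ⟩
  4 * ((4 * p + 1) * (c * c))                   ≤⟨ *-monoʳ-≤ 4 (*-monoʳ-≤ (4 * p + 1) (*-mono-≤ c≤c′ c≤c′)) ⟩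
  4 * ((4 * p + 1) * (c′ * c′))                 ≤⟨ *-monoʳ-≤ 4 (*-monoˡ-≤ (c′ * c′) (m≤m+n (4 * p + 1) 2)) ⟩
  4 * ((4 * p + 1 + 2) * (c′ * c′))             ≡⟨ regroup₂ p (c′ * c′) ⟩
  4 * (2 * suc (p * 2) + 1) * (c′ * c′)         ∎
  where
  open ≤-Reasoning
  c = central (p * 2)
  c′ = central (suc (p * 2))
  regroup₁ : ∀ x → 2 * x * (2 * x) ≡ 4 * (x * x)
  regroup₁ = solve-∀
  regroup₂ : ∀ p d → 4 * ((4 * p + 1 + 2) * d) ≡ 4 * (2 * suc (p * 2) + 1) * d
  regroup₂ = solve-∀
  c≤c′ : c ≤ c′
  c≤c′ = *-cancelˡ-≤ (suc p) (begin
    suc p * c            ≤⟨ *-monoˡ-≤ c (s≤s (p≤2p p)) ⟩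
    suc (p * 2) * c      ≡⟨ central-even-suc p ⟨
    suc p * c′           ∎)

m*m≤n*n⇒m≤n : ∀ {m n} → m * m ≤ n * n → m ≤ n
m*m≤n*n⇒m≤n {m} {n} m²≤n² with m ≤? n
... | yes m≤n = m≤n
... | no m≰n = contradiction m²≤n² (<⇒≱ (*-mono-< (≰⇒> m≰n) (≰⇒> m≰n)))

-- Central coefficients have order at least 2^n/√n, which eventually beats any fixed multiple of
-- 2^n/n. Squares are compared to avoid roots; 4(2n+1) ≤ 12n gives the threshold.
q*2^n≤n*central : ∀ q n → suc (12 * (q * q)) ≤ n → q * 2 ^ n ≤ n * central n
q*2^n≤n*central q n 12q²<n = m*m≤n*n⇒m≤n (begin
  q * 2 ^ n * (q * 2 ^ n)                          ≡⟨ regroup₁ q (2 ^ n) ⟩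
  q * q * (2 ^ n * 2 ^ n)                          ≤⟨ *-monoʳ-≤ (q * q) (2^n*2^n≤4*[2n+1]*central² n) ⟩
  q * q * (4 * (2 * n + 1) * d)
    ≤⟨ *-monoʳ-≤ (q * q) (*-monoˡ-≤ d (*-monoʳ-≤ 4 (+-monoʳ-≤ (2 * n) 1≤n))) ⟩
  q * q * (4 * (2 * n + n) * d)                    ≡⟨ regroup₂ q n d ⟩
  12 * (q * q) * (n * d)                           ≤⟨ *-monoˡ-≤ (n * d) (<⇒≤ 12q²<n) ⟩
  n * (n * d)                                      ≡⟨ regroup₃ n (central n) ⟩
  n * central n * (n * central n)                  ∎)
  where
  open ≤-Reasoning
  d = central n * central n
  1≤n : 1 ≤ n
  1≤n = ≤-trans (s≤s z≤n) 12q²<n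
  regroup₁ : ∀ q x → q * x * (q * x) ≡ q * q * (x * x)
  regroup₁ = solve-∀
  regroup₂ : ∀ q n d → q * q * (4 * (2 * n + n) * d) ≡ 12 * (q * q) * (n * d)
  regroup₂ = solve-∀
  regroup₃ : ∀ n c → n * (n * (c * c)) ≡ n * c * (n * c)
  regroup₃ = solve-∀

-- Counting subsets and swaps

-- Recursion on the first coordinate makes splitting a family along the first element definitional.
sumₛ : (Subset n → ℕ) → ℕ
sumₛ {zero}  w = w []
sumₛ {suc n} w = sumₛ (w ∘ (outside ∷_)) + sumₛ (w ∘ (inside ∷_))

sumₛ-cong : {v w : Subset n → ℕ} → (∀ A → v A ≡ w A) → sumₛ v ≡ sumₛ w
sumₛ-cong {zero}  v≡w = v≡w []
sumₛ-cong {suc n} v≡w = cong₂ _+_ (sumₛ-cong (v≡w ∘ (outside ∷_))) (sumₛ-cong (v≡w ∘ (inside ∷_)))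

sumₛ-mono-≤ : {v w : Subset n → ℕ} → (∀ A → v A ≤ w A) → sumₛ v ≤ sumₛ w
sumₛ-mono-≤ {zero}  v≤w = v≤w []
sumₛ-mono-≤ {suc n} v≤w = +-mono-≤ (sumₛ-mono-≤ (v≤w ∘ (outside ∷_))) (sumₛ-mono-≤ (v≤w ∘ (inside ∷_)))

sumₛ-mono-< : {v w : Subset n → ℕ} → (∀ A → v A ≤ w A) → ∀ A → v A < w A → sumₛ v < sumₛ w
sumₛ-mono-< v≤w [] v<w = v<w
sumₛ-mono-< v≤w (outside ∷ A) v<w =
  +-mono-<-≤ (sumₛ-mono-< (v≤w ∘ (outside ∷_)) A v<w) (sumₛ-mono-≤ (v≤w ∘ (inside ∷_)))
sumₛ-mono-< v≤w (inside ∷ A) v<w =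
  +-mono-≤-< (sumₛ-mono-≤ (v≤w ∘ (outside ∷_))) (sumₛ-mono-< (v≤w ∘ (inside ∷_)) A v<w)

+-interchange : ∀ a b c d → (a + b) + (c + d) ≡ (a + c) + (b + d)
+-interchange = solve-∀

sumₛ-distrib-+ : (v w : Subset n → ℕ) → sumₛ (λ A → v A + w A) ≡ sumₛ v + sumₛ w
sumₛ-distrib-+ {zero}  v w = refl
sumₛ-distrib-+ {suc n} v w = trans
  (cong₂ _+_ (sumₛ-distrib-+ (v ∘ (outside ∷_)) (w ∘ (outside ∷_))) (sumₛ-distrib-+ (v ∘ (inside ∷_)) (w ∘ (inside ∷_))))
  (+-interchange (sumₛ (v ∘ (outside ∷_))) _ _ _)

sumₛ-*ʳ : (w : Subset n → ℕ) (c : ℕ) → sumₛ (λ A → w A * c) ≡ sumₛ w * c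
sumₛ-*ʳ {zero}  w c = refl
sumₛ-*ʳ {suc n} w c = trans
  (cong₂ _+_ (sumₛ-*ʳ (w ∘ (outside ∷_)) c) (sumₛ-*ʳ (w ∘ (inside ∷_)) c))
  (sym (*-distribʳ-+ c (sumₛ (w ∘ (outside ∷_))) (sumₛ (w ∘ (inside ∷_)))))

sumₛ-const : ∀ n c → sumₛ {n} (λ _ → c) ≡ 2 ^ n * c
sumₛ-const zero    c = sym (*-identityˡ c)
sumₛ-const (suc n) c = trans (cong₂ _+_ (sumₛ-const n c) (sumₛ-const n c)) (double (2 ^ n) c)
  where
  double : ∀ x c → x * c + x * c ≡ 2 * x * c
  double = solve-∀

sumₛ-sum-comm : ∀ {m} (w : Subset n → Fin m → ℕ) → sumₛ (λ A → sum (w A)) ≡ sum (λ x → sumₛ (λ A → w A x))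
sumₛ-sum-comm {zero}  w = refl
sumₛ-sum-comm {suc n} w = trans
  (cong₂ _+_ (sumₛ-sum-comm (w ∘ (outside ∷_))) (sumₛ-sum-comm (w ∘ (inside ∷_))))
  (sym (∑-distrib-+ (λ x → sumₛ (λ A → w (outside ∷ A) x)) (λ x → sumₛ (λ A → w (inside ∷ A) x))))

flip : Fin n → Subset n → Subset n
flip x A = updateAt A x not

sumₛ-flip : (x : Fin n) (w : Subset n → ℕ) → sumₛ (λ A → w (flip x A)) ≡ sumₛ w
sumₛ-flip zero    w = +-comm (sumₛ (w ∘ (inside ∷_))) _
sumₛ-flip (suc x) w = cong₂ _+_ (sumₛ-flip x (w ∘ (outside ∷_))) (sumₛ-flip x (w ∘ (inside ∷_)))

flip-involutive : (x : Fin n) (A : Subset n) → flip x (flip x A) ≡ A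
flip-involutive x A = trans (updateAt-updateAt x A) (updateAt-id-local x A (not-involutive (lookup A x)))

𝟙 : Bool → ℕ
𝟙 true  = 1
𝟙 false = 0

𝟙≡0 : ∀ b → ¬ T b → 𝟙 b ≡ 0
𝟙≡0 true  ¬Tb = contradiction _ ¬Tb
𝟙≡0 false _   = refl

count : (Subset n → Bool) → ℕ
count f = sumₛ (𝟙 ∘ f)

∣p∣≡sum : (p : Subset n) → ∣ p ∣ ≡ sum (λ x → 𝟙 (lookup p x))
∣p∣≡sum []            = refl
∣p∣≡sum (inside ∷ p)  = cong suc (∣p∣≡sum p)
∣p∣≡sum (outside ∷ p) = ∣p∣≡sum p

∣p∪q∣≤∣p∣+∣q∣ : (p q : Subset n) → ∣ p ∪ q ∣ ≤ ∣ p ∣ + ∣ q ∣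
∣p∪q∣≤∣p∣+∣q∣ []            []            = z≤n
∣p∪q∣≤∣p∣+∣q∣ (inside ∷ p)  (inside ∷ q)  =
  s≤s (≤-trans (∣p∪q∣≤∣p∣+∣q∣ p q) (+-monoʳ-≤ ∣ p ∣ (n≤1+n ∣ q ∣)))
∣p∪q∣≤∣p∣+∣q∣ (inside ∷ p)  (outside ∷ q) = s≤s (∣p∪q∣≤∣p∣+∣q∣ p q)
∣p∪q∣≤∣p∣+∣q∣ (outside ∷ p) (inside ∷ q)  =
  ≤-trans (s≤s (∣p∪q∣≤∣p∣+∣q∣ p q)) (≤-reflexive (sym (+-suc ∣ p ∣ ∣ q ∣)))
∣p∪q∣≤∣p∣+∣q∣ (outside ∷ p) (outside ∷ q) = ∣p∪q∣≤∣p∣+∣q∣ p q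

-- Since exactly one of x and y lies in `A`, the double flip exchanges them; this covers both
-- directions of a swap at once.
NoSwap : (Subset n → Bool) → Subset n → Subset n → Set
NoSwap f A Z = ∀ x → x ∉ Z → ∀ y → y ∉ Z → lookup A x ≢ lookup A y → ¬ T (f (flip x (flip y A)))

-- The double counting below runs over the pairs (A , x) with x free for A, each sent to A with x flipped.
record Free (f : Subset n → Bool) (z : ℕ) (A : Subset n) : Set where
  field
    free     : Subset n
    many     : 𝟙 (f A) * (n ∸ z) ≤ ∣ free ∣
    member   : Nonempty free → T (f A)
    few-rest : Nonempty free → ∣ ∁ free ∣ ≤ z
    no-swap  : ∀ {x y} → x ∈ free → y ∈ free → lookup A x ≢ lookup A y → ¬ T (f (flip x (flip y A)))

∁∁p⊆p : (p : Subset n) → ∁ (∁ p) ⊆ p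
∁∁p⊆p p x∈ = x∉∁p⇒x∈p (x∈∁p⇒x∉p x∈)

-- A member of the family takes the complement of its blocking set; a nonmember takes the empty set,
-- so that its lower bound is 0 and the other fields are vacuous.
toFree : (f : Subset n → Bool) (z : ℕ) → (∀ A → T (f A) → ∃ λ Z → ∣ Z ∣ ≤ z × NoSwap f A Z) → ∀ A → Free f z A
toFree {n} f z blocked A with T? (f A)
... | no fA≢true = record
  { free     = ⊥
  ; many     = ≤-trans (≤-reflexive (cong (_* (n ∸ z)) (𝟙≡0 (f A) fA≢true))) z≤n
  ; member   = λ (_ , x∈⊥) → contradiction x∈⊥ ∉⊥
  ; few-rest = λ (_ , x∈⊥) → contradiction x∈⊥ ∉⊥
  ; no-swap  = λ x∈⊥ → contradiction x∈⊥ ∉⊥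
  }
... | yes fA with blocked A fA
... | Z , ∣Z∣≤z , noSwap = record
  { free     = ∁ Z
  ; many     = begin
      𝟙 (f A) * (n ∸ z)   ≤⟨ *-monoˡ-≤ (n ∸ z) (𝟙≤1 (f A)) ⟩
      1 * (n ∸ z)         ≡⟨ *-identityˡ (n ∸ z) ⟩
      n ∸ z               ≤⟨ ∸-monoʳ-≤ n ∣Z∣≤z ⟩
      n ∸ ∣ Z ∣           ≡⟨ ∣∁p∣≡n∸∣p∣ Z ⟨
      ∣ ∁ Z ∣             ∎
  ; member   = λ _ → fA
  ; few-rest = λ _ → ≤-trans (p⊆q⇒∣p∣≤∣q∣ (∁∁p⊆p Z)) ∣Z∣≤z
  ; no-swap  = λ x∈∁Z y∈∁Z → noSwap _ (x∈∁p⇒x∉p x∈∁Z) _ (x∈∁p⇒x∉p y∈∁Z)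
  }
  where
  open ≤-Reasoning
  𝟙≤1 : ∀ b → 𝟙 b ≤ 1
  𝟙≤1 true  = ≤-refl
  𝟙≤1 false = z≤n

module _ (f : Subset n → Bool) (z : ℕ) (F : ∀ A → Free f z A) where
  private module F A = Free (F A)

  -- The preimage of `S` under the map (A , x) ↦ `flip x A`, recorded as a set of elements x.
  fibre : Subset n → Subset n
  fibre S = tabulate (λ x → lookup (F.free (flip x S)) x)

  ∈-fibre⁻ : ∀ {S x} → x ∈ fibre S → x ∈ F.free (flip x S)
  ∈-fibre⁻ {S} {x} x∈ = lookup⇒[]= x _ (trans (sym (lookup∘tabulate _ x)) ([]=⇒lookup x∈))

  -- If x and x₀ lie in the fibre of S and on the same side of S, then S with x flipped is obtained from S with x₀
  -- flipped by swapping x and x₀.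
  side-fibre-small : ∀ S q → q ⊆ fibre S → (∀ {x y} → x ∈ q → y ∈ q → lookup S x ≡ lookup S y) → ∣ q ∣ ≤ suc z
  side-fibre-small S q q⊆ same with nonempty? q
  ... | no empty = ≤-trans (≤-reflexive (trans (cong ∣_∣ (Empty-unique empty)) (∣⊥∣≡0 n))) z≤n
  ... | yes (x₀ , x₀∈q) = begin
    ∣ q ∣                     ≤⟨ p⊆q⇒∣p∣≤∣q∣ q⊆rest ⟩
    ∣ ⁅ x₀ ⁆ ∪ ∁ U ∣          ≤⟨ ∣p∪q∣≤∣p∣+∣q∣ ⁅ x₀ ⁆ (∁ U) ⟩
    ∣ ⁅ x₀ ⁆ ∣ + ∣ ∁ U ∣      ≡⟨ cong (_+ ∣ ∁ U ∣) (∣⁅x⁆∣≡1 x₀) ⟩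
    suc ∣ ∁ U ∣               ≤⟨ s≤s (F.few-rest A (x₀ , x₀∈U)) ⟩
    suc z                     ∎
    where
    open ≤-Reasoning
    A = flip x₀ S
    U = F.free A
    x₀∈U : x₀ ∈ U
    x₀∈U = ∈-fibre⁻ (q⊆ x₀∈q)
    q⊆rest : q ⊆ ⁅ x₀ ⁆ ∪ ∁ U
    q⊆rest {x} x∈q with x Fin.≟ x₀
    ... | yes refl = x∈p∪q⁺ (inj₁ (x∈⁅x⁆ x))
    ... | no x≢x₀ = x∈p∪q⁺ (inj₂ (x∉p⇒x∈∁p λ x∈U →
      F.no-swap A x∈U x₀∈U Ax≢Ax₀
        (subst (T ∘ f) (cong (flip x) (sym (flip-involutive x₀ S))) (F.member (flip x S) (x , ∈-fibre⁻ (q⊆ x∈q))))))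
      where
      -- Flipping `x₀` changes its side while `x` keeps its own, and both were on the same side of
      -- `S`.
      Ax≢Ax₀ : lookup A x ≢ lookup A x₀
      Ax≢Ax₀ eq = not-¬ (sym (same x₀∈q x∈q))
        (trans (sym (lookup∘updateAt′ x x₀ x≢x₀ S)) (trans eq (lookup∘updateAt x₀ S)))

  fibre-small : ∀ S → ∣ fibre S ∣ ≤ suc z + suc z
  fibre-small S = begin
    ∣ fibre S ∣                                 ≤⟨ p⊆q⇒∣p∣≤∣q∣ split ⟩
    ∣ (fibre S ∩ S) ∪ (fibre S ∩ ∁ S) ∣         ≤⟨ ∣p∪q∣≤∣p∣+∣q∣ (fibre S ∩ S) (fibre S ∩ ∁ S) ⟩
    ∣ fibre S ∩ S ∣ + ∣ fibre S ∩ ∁ S ∣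
      ≤⟨ +-mono-≤ (side-fibre-small S _ (proj₁ ∘ x∈p∩q⁻ _ _) (λ x∈ y∈ → trans (in-S x∈) (sym (in-S y∈))))
                  (side-fibre-small S _ (proj₁ ∘ x∈p∩q⁻ _ _) (λ x∈ y∈ → trans (out-S x∈) (sym (out-S y∈)))) ⟩
    suc z + suc z                               ∎
    where
    open ≤-Reasoning
    split : fibre S ⊆ (fibre S ∩ S) ∪ (fibre S ∩ ∁ S)
    split {x} x∈ with x ∈? S
    ... | yes x∈S = x∈p∪q⁺ (inj₁ (x∈p∩q⁺ (x∈ , x∈S)))
    ... | no x∉S = x∈p∪q⁺ (inj₂ (x∈p∩q⁺ (x∈ , x∉p⇒x∈∁p x∉S)))
    in-S : ∀ {x} → x ∈ fibre S ∩ S → lookup S x ≡ true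
    in-S x∈ = []=⇒lookup (proj₂ (x∈p∩q⁻ (fibre S) S x∈))
    out-S : ∀ {x} → x ∈ fibre S ∩ ∁ S → lookup S x ≡ false
    out-S {x} x∈ = ¬-not (x∈∁p⇒x∉p (proj₂ (x∈p∩q⁻ (fibre S) (∁ S) x∈)) ∘ lookup⇒[]= x S)

  -- The pairs (A , x) number at least n - z for each member A, and at most 2z + 2 for each image S.
  free-count : count f * (n ∸ z) ≤ 2 ^ n * (suc z + suc z)
  free-count = begin
    count f * (n ∸ z)                                        ≡⟨ sumₛ-*ʳ (𝟙 ∘ f) (n ∸ z) ⟨
    sumₛ (λ A → 𝟙 (f A) * (n ∸ z))                           ≤⟨ sumₛ-mono-≤ F.many ⟩
    sumₛ (λ A → ∣ F.free A ∣)                                ≡⟨ sumₛ-cong (λ A → ∣p∣≡sum (F.free A)) ⟩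
    sumₛ (λ A → sum (λ x → weight x A))                      ≡⟨ sumₛ-sum-comm (λ A x → weight x A) ⟩
    -- For each x, the substitution A = `flip x S` regroups the pairs by their image.
    sum (λ x → sumₛ (weight x))                              ≡⟨ sum-cong-≗ (λ x → sumₛ-flip x (weight x)) ⟨
    sum (λ x → sumₛ (λ S → weight x (flip x S)))             ≡⟨ sumₛ-sum-comm (λ S x → weight x (flip x S)) ⟨
    sumₛ (λ S → sum (λ x → weight x (flip x S)))             ≡⟨ sumₛ-cong fibre-size ⟨
    sumₛ (λ S → ∣ fibre S ∣)                                 ≤⟨ sumₛ-mono-≤ fibre-small ⟩
    sumₛ {n} (λ S → suc z + suc z)                           ≡⟨ sumₛ-const n (suc z + suc z) ⟩
    2 ^ n * (suc z + suc z)                                  ∎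
    where
    open ≤-Reasoning
    weight : Fin n → Subset n → ℕ
    weight x A = 𝟙 (lookup (F.free A) x)
    fibre-size : ∀ S → ∣ fibre S ∣ ≡ sum (λ x → weight x (flip x S))
    fibre-size S = trans (∣p∣≡sum (fibre S))
      (sum-cong-≗ {n} (λ x → cong 𝟙 (lookup∘tabulate (λ y → lookup (F.free (flip y S)) y) x)))

swap-free-count : (f : Subset n → Bool) (z : ℕ) → (∀ A → T (f A) → ∃ λ Z → ∣ Z ∣ ≤ z × NoSwap f A Z) →
  count f * (n ∸ z) ≤ 2 ^ n * (suc z + suc z)
swap-free-count f z blocked = free-count f z (toFree f z blocked)

-- Chains modulo a set of elements

-- For `Y = ∁ D` this is strict inclusion of the parts outside `D`. Keeping `Y` separate lets a walk
-- enlarge `D` later without losing earlier witnesses of strictness.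
Below : (D Y : Subset n) → Rel (Subset n) 0ℓ
Below D Y A B = (∀ {x} → x ∉ D → x ∈ A → x ∈ B) × ∃ λ y → y ∈ Y × y ∉ A × y ∈ B

data Chain (f : Subset n → Bool) (R : Rel (Subset n) 0ℓ) : ℕ → Subset n → Set where
  base : ∀ {A} → T (f A) → Chain f R 1 A
  step : ∀ {k A B} → Chain f R k A → R A B → T (f B) → Chain f R (suc k) B

-- Phrased through the l deleted elements rather than the n - l kept ones; this avoids truncated
-- subtraction and fits induction on the ground set.
TraceFree : ℕ → ℕ → (Subset n → Bool) → Set
TraceFree l k f = ∀ D → ∣ D ∣ ≡ l → ∀ {A} → ¬ Chain f (Below D (∁ D)) (suc k) A

-- The map `e` may use the membership proof because lifting a trace requires choosing a preimage
-- that lies in the family.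
Chain-map : {f : Subset m → Bool} {g : Subset n → Bool} {R : Rel (Subset m) 0ℓ} {S : Rel (Subset n) 0ℓ}
  (e : ∀ A → T (f A) → Subset n) → (∀ A t → T (g (e A t))) → (∀ {A B} s t → R A B → S (e A s) (e B t)) →
  ∀ {k A} → Chain f R k A → ∃ λ t → Chain g S k (e A t)
Chain-map e e∈g R⇒S (base t) = t , base (e∈g _ t)
Chain-map e e∈g R⇒S (step c r t) with Chain-map e e∈g R⇒S c
... | s , c′ = t , step c′ (R⇒S s t r) (e∈g _ t)

Chain-weaken : {f : Subset n → Bool} {R S : Rel (Subset n) 0ℓ} → (∀ {A B} → R A B → S A B) →
  ∀ {k A} → Chain f R k A → Chain f S k A
Chain-weaken R⇒S c = proj₂ (Chain-map (λ A _ → A) (λ _ t → t) (λ _ _ → R⇒S) c)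

Chain-head : {f : Subset n → Bool} {R : Rel (Subset n) 0ℓ} → ∀ {k A} → Chain f R k A → T (f A)
Chain-head (base t)     = t
Chain-head (step _ _ t) = t

Below-mono : {D D′ Y Y′ : Subset n} → D ⊆ D′ → Y ⊆ Y′ → ∀ {A B} → Below D Y A B → Below D′ Y′ A B
Below-mono D⊆D′ Y⊆Y′ (A⊆B , y , y∈Y , y∉A , y∈B) = (λ x∉D′ → A⊆B (x∉D′ ∘ D⊆D′)) , y , Y⊆Y′ y∈Y , y∉A , y∈B

-- The new first element is deleted, so the two sets may disagree on it.
Below-inside : {D Y A B : Subset n} → ∀ s t → Below D Y A B → Below (inside ∷ D) (outside ∷ Y) (s ∷ A) (t ∷ B)
Below-inside {D = D} {A = A} {B = B} s t (A⊆B , y , y∈Y , y∉A , y∈B) =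
  s∷A⊆t∷B , suc y , there y∈Y , y∉A ∘ drop-there , there y∈B
  where
  s∷A⊆t∷B : ∀ {x} → x ∉ inside ∷ D → x ∈ s ∷ A → x ∈ t ∷ B
  s∷A⊆t∷B {zero}  x∉ _ = contradiction here x∉
  s∷A⊆t∷B {suc x} x∉ (there x∈A) = there (A⊆B (x∉ ∘ there) x∈A)

Below-outside : {D Y A B : Subset n} → ∀ s → Below D Y A B → Below (outside ∷ D) (inside ∷ Y) (s ∷ A) (s ∷ B)
Below-outside {D = D} {A = A} {B = B} s (A⊆B , y , y∈Y , y∉A , y∈B) =
  s∷A⊆s∷B , suc y , there y∈Y , y∉A ∘ drop-there , there y∈B
  where
  s∷A⊆s∷B : ∀ {x} → x ∉ outside ∷ D → x ∈ s ∷ A → x ∈ s ∷ B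
  s∷A⊆s∷B {zero}  x∉ here = here
  s∷A⊆s∷B {suc x} x∉ (there x∈A) = there (A⊆B (x∉ ∘ there) x∈A)

-- Splitting a family along one element

traceₛ pairsₛ : (Subset (suc n) → Bool) → Subset n → Bool
traceₛ f A = f (outside ∷ A) ∨ f (inside ∷ A)
pairsₛ f A = f (outside ∷ A) ∧ f (inside ∷ A)

-- Inclusion-exclusion for the two sections of `f` at the first element.
count-trace-pairs : (f : Subset (suc n) → Bool) → count f ≡ count (traceₛ f) + count (pairsₛ f)
count-trace-pairs f = begin
  sumₛ (λ A → 𝟙 (f (outside ∷ A))) + sumₛ (λ A → 𝟙 (f (inside ∷ A)))
    ≡⟨ sumₛ-distrib-+ (λ A → 𝟙 (f (outside ∷ A))) (λ A → 𝟙 (f (inside ∷ A))) ⟨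
  sumₛ (λ A → 𝟙 (f (outside ∷ A)) + 𝟙 (f (inside ∷ A)))
    ≡⟨ sumₛ-cong (λ A → 𝟙-∨-∧ (f (outside ∷ A)) (f (inside ∷ A))) ⟩
  sumₛ (λ A → 𝟙 (traceₛ f A) + 𝟙 (pairsₛ f A))
    ≡⟨ sumₛ-distrib-+ (𝟙 ∘ traceₛ f) (𝟙 ∘ pairsₛ f) ⟩
  count (traceₛ f) + count (pairsₛ f)                                  ∎
  where
  open ≡-Reasoning
  𝟙-∨-∧ : ∀ a b → 𝟙 a + 𝟙 b ≡ 𝟙 (a ∨ b) + 𝟙 (a ∧ b)
  𝟙-∨-∧ true  true  = refl
  𝟙-∨-∧ true  false = refl
  𝟙-∨-∧ false true  = refl
  𝟙-∨-∧ false false = refl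

-- Each set of the chain is lifted to an arbitrary preimage in `f`; deleting the first element hides
-- the choice.
trace-free : ∀ {l k} {f : Subset (suc n) → Bool} → TraceFree (suc l) k f → TraceFree l k (traceₛ f)
trace-free {f = f} free D ∣D∣≡l c =
  free (inside ∷ D) (cong suc ∣D∣≡l)
    (proj₂ (Chain-map (λ A t → proj₁ (extend A t)) (λ A t → proj₂ (extend A t)) (λ _ _ → Below-inside _ _) c))
  where
  extend : ∀ A → T (traceₛ f A) → ∃ λ A′ → T (f A′)
  extend′ : ∀ A → T (traceₛ f A) → ∃ λ s → T (f (s ∷ A))
  extend′ A t = [ outside ,_ , inside ,_ ]′ (Equivalence.to T-∨ t)
  extend A t = proj₁ (extend′ A t) ∷ A , proj₂ (extend′ A t)

pairs-free : ∀ {l k} {f : Subset (suc n) → Bool} → TraceFree l (suc k) f → TraceFree l k (pairsₛ f)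
pairs-free {f = f} free D ∣D∣≡l {A} c =
  free (outside ∷ D) ∣D∣≡l
    -- The lifted chain omits the first element throughout; its top with that element added is one
    -- further set of the family.
    (step (proj₂ (Chain-map (λ A _ → outside ∷ A) (λ A t → proj₁ (both A t)) (λ _ _ → Below-outside outside) c))
      (A⊆A , zero , here , (λ ()) , here) (proj₂ (both A (Chain-head c))))
  where
  both : ∀ A → T (pairsₛ f A) → T (f (outside ∷ A)) × T (f (inside ∷ A))
  both A = Equivalence.to T-∧
  A⊆A : ∀ {x} → x ∉ outside ∷ D → x ∈ outside ∷ A → x ∈ inside ∷ A
  A⊆A _ (there x∈A) = there x∈A

-- Cores and walks of swaps

Blocked : ℕ → (Subset n → Bool) → Subset n → Set
Blocked z f A = ∃ λ Z → ∣ Z ∣ ≤ z × NoSwap f A Z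

-- Exhaustive search; decidability is what lets `core` be a Boolean predicate.
blocked? : ∀ z (f : Subset n → Bool) A → Dec (Blocked z f A)
blocked? z f A = anySubset? λ Z → (∣ Z ∣ ≤? z) ×-dec
  (Fin.all? λ x → ¬? (x ∈? Z) →-dec (Fin.all? λ y → ¬? (y ∈? Z) →-dec
    (¬? (lookup A x ≟ᵇ lookup A y) →-dec ¬? (T? (f (flip x (flip y A)))))))

-- From a member of core z i f one can make i successive swaps inside f, each avoiding any z prescribed elements.
core : ℕ → ℕ → (Subset n → Bool) → Subset n → Bool
core z zero    f = f
core z (suc i) f A = core z i f A ∧ not ⌊ blocked? z (core z i f) A ⌋

core-⊆ : ∀ z i (f : Subset n → Bool) {A} → T (core z i f A) → T (f A)
core-⊆ z zero    f t = t
core-⊆ z (suc i) f t = core-⊆ z i f (proj₁ (Equivalence.to T-∧ t))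

-- Each round discards the sets that are blocked in the current core, and these are few by
-- `swap-free-count`.
core-count : ∀ z i (f : Subset n → Bool) →
  count f * (n ∸ z) ≤ count (core z i f) * (n ∸ z) + i * (2 ^ n * (suc z + suc z))
core-count z zero f = m≤m+n _ 0
core-count {n} z (suc i) f = begin
  count f * w                                         ≤⟨ core-count z i f ⟩
  count g * w + i * K                                 ≡⟨ cong (λ c → c * w + i * K) split ⟩
  (count (core z (suc i) f) + count bad) * w + i * K  ≡⟨ regroup (count (core z (suc i) f)) (count bad) w (i * K) ⟩
  count (core z (suc i) f) * w + (count bad * w + i * K)
    ≤⟨ +-monoʳ-≤ (count (core z (suc i) f) * w) (+-monoˡ-≤ (i * K) (swap-free-count bad z bad-blocked)) ⟩
  count (core z (suc i) f) * w + (K + i * K)          ∎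
  where
  open ≤-Reasoning
  w = n ∸ z
  K = 2 ^ n * (suc z + suc z)
  g = core z i f
  bad : Subset n → Bool
  bad A = g A ∧ ⌊ blocked? z g A ⌋
  regroup : ∀ a b w c → (a + b) * w + c ≡ a * w + (b * w + c)
  regroup = solve-∀
  𝟙-split : ∀ a b → 𝟙 a ≡ 𝟙 (a ∧ not b) + 𝟙 (a ∧ b)
  𝟙-split false b     = refl
  𝟙-split true  false = refl
  𝟙-split true  true  = refl
  split : count g ≡ count (core z (suc i) f) + count bad
  split = trans (sumₛ-cong (λ A → 𝟙-split (g A) ⌊ blocked? z g A ⌋)) (sumₛ-distrib-+ (𝟙 ∘ core z (suc i) f) (𝟙 ∘ bad))
  bad-blocked : ∀ A → T (bad A) → Blocked z bad A
  bad-blocked A t with toWitness {a? = blocked? z g A} (proj₂ (Equivalence.to (T-∧ {g A}) t))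
  ... | Z , ∣Z∣≤z , noSwap = Z , ∣Z∣≤z , λ x x∉Z y y∉Z Ax≢Ay → noSwap x x∉Z y y∉Z Ax≢Ay ∘ proj₁ ∘ Equivalence.to T-∧

∣flip∣ : (x : Fin n) (D : Subset n) → x ∉ D → ∣ flip x D ∣ ≡ suc ∣ D ∣
∣flip∣ zero    (inside ∷ D)  x∉D = contradiction here x∉D
∣flip∣ zero    (outside ∷ D) x∉D = refl
∣flip∣ (suc x) (inside ∷ D)  x∉D = cong suc (∣flip∣ x D (x∉D ∘ there))
∣flip∣ (suc x) (outside ∷ D) x∉D = ∣flip∣ x D (x∉D ∘ there)

∈-flip-other : {x y : Fin n} {A : Subset n} → y ≢ x → y ∈ A → y ∈ flip x A
∈-flip-other {x = x} {y} {A} y≢x = updateAt-minimal y x A y≢x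

∈-flip-self : {x : Fin n} {A : Subset n} → x ∉ A → x ∈ flip x A
∈-flip-self {x = zero}  {outside ∷ A} x∉A = here
∈-flip-self {x = zero}  {inside ∷ A}  x∉A = contradiction here x∉A
∈-flip-self {x = suc x} {s ∷ A}       x∉A = there (∈-flip-self (x∉A ∘ there))

∈-flip⁻ : {x y : Fin n} {A : Subset n} → y ≢ x → y ∈ flip x A → y ∈ A
∈-flip⁻ {x = x} {y} {A} y≢x y∈ = subst (y ∈_) (flip-involutive x A) (∈-flip-other y≢x y∈)

-- D collects the elements removed so far and Y those added; avoiding both keeps the whole walk a chain outside D.
core-walk : ∀ z i j (f : Subset n → Bool) {D Y A} → TraceFree (i + j) (i + j) f → (i + j) + (i + j) ≤ z →
  ∣ D ∣ ≡ j → ∣ Y ∣ ≤ j → Y ⊆ ∁ D → Chain f (Below D Y) (suc j) A → ¬ T (core z i f A)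
core-walk z zero j f {D} free _ ∣D∣≡j _ Y⊆∁D c _ = free D ∣D∣≡j (Chain-weaken (Below-mono (λ x∈ → x∈) Y⊆∁D) c)
core-walk {n} z (suc i) j f {D} {Y} {A} free 2k≤z ∣D∣≡j ∣Y∣≤j Y⊆∁D c t
  with blocked? z (core z i f) A | Equivalence.to (T-∧ {core z i f A}) t
-- A set of the next core is unblocked, yet `D ∪ Y` would block it: any swap avoiding `D ∪ Y`
-- continues the walk and is refuted by recursion.
... | no ¬blocked | _ = ¬blocked (D ∪ Y , ∣Z∣≤z , noSwap)
  where
  ∣Z∣≤z : ∣ D ∪ Y ∣ ≤ z
  ∣Z∣≤z = begin
    ∣ D ∪ Y ∣                    ≤⟨ ∣p∪q∣≤∣p∣+∣q∣ D Y ⟩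
    ∣ D ∣ + ∣ Y ∣                ≤⟨ +-mono-≤ (≤-reflexive ∣D∣≡j) ∣Y∣≤j ⟩
    j + j                        ≤⟨ +-mono-≤ (m≤n+m j (suc i)) (m≤n+m j (suc i)) ⟩
    (suc i + j) + (suc i + j)    ≤⟨ 2k≤z ⟩
    z                            ∎
    where open ≤-Reasoning
  ∉D : ∀ {x} → x ∉ D ∪ Y → x ∉ D
  ∉D x∉ = x∉ ∘ x∈p∪q⁺ ∘ inj₁
  ∉Y : ∀ {x} → x ∉ D ∪ Y → x ∉ Y
  ∉Y x∉ = x∉ ∘ x∈p∪q⁺ ∘ inj₂
  swap : ∀ r a → r ∉ D ∪ Y → a ∉ D ∪ Y → r ∈ A → a ∉ A → ¬ T (core z i f (flip r (flip a A)))
  swap r a r∉ a∉ r∈A a∉A t = core-walk z i (suc j) f {flip r D} {Y ∪ ⁅ a ⁆}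
    -- One swap passes from those to come to those done, so the total is unchanged.
    (subst (λ k → TraceFree k k f) (sym (+-suc i j)) free) (subst (λ k → k + k ≤ z) (sym (+-suc i j)) 2k≤z)
    (trans (∣flip∣ r D (∉D r∉)) (cong suc ∣D∣≡j))
    (≤-trans (∣p∪q∣≤∣p∣+∣q∣ Y ⁅ a ⁆) (≤-trans (+-mono-≤ ∣Y∣≤j (≤-reflexive (∣⁅x⁆∣≡1 a))) (≤-reflexive (+-comm j 1))))
    Y′⊆∁D′
    (step (Chain-weaken (Below-mono D⊆D′ (p⊆p∪q ⁅ a ⁆)) c)
      (A⊆B , a , x∈p∪q⁺ (inj₂ (x∈⁅x⁆ a)) , a∉A , ∈-flip-other a≢r (∈-flip-self a∉A)) (core-⊆ z i f t))
    t
    where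
    a≢r : a ≢ r
    a≢r refl = a∉A r∈A
    D⊆D′ : D ⊆ flip r D
    D⊆D′ {x} x∈D = ∈-flip-other (λ { refl → ∉D r∉ x∈D }) x∈D
    -- The old witnesses survive because `r` avoids `Y`, the new one because `a` avoids `D` and
    -- differs from `r`.
    Y′⊆∁D′ : Y ∪ ⁅ a ⁆ ⊆ ∁ (flip r D)
    Y′⊆∁D′ {y} y∈ with x∈p∪q⁻ Y ⁅ a ⁆ y∈
    ... | inj₁ y∈Y = x∉p⇒x∈∁p (x∈∁p⇒x∉p (Y⊆∁D y∈Y) ∘ ∈-flip⁻ (λ { refl → ∉Y r∉ y∈Y }))
    ... | inj₂ y∈a with x∈⁅y⁆⇒x≡y a y∈a
    ... | refl = x∉p⇒x∈∁p (∉D a∉ ∘ ∈-flip⁻ a≢r)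
    A⊆B : ∀ {x} → x ∉ flip r D → x ∈ A → x ∈ flip r (flip a A)
    A⊆B x∉D′ x∈A = ∈-flip-other (λ { refl → x∉D′ (∈-flip-self (∉D r∉)) }) (∈-flip-other (λ { refl → a∉A x∈A }) x∈A)
  noSwap : NoSwap (core z i f) A (D ∪ Y)
  noSwap x x∉ y y∉ Ax≢Ay with x ∈? A | y ∈? A
  ... | yes x∈A | no y∉A = swap x y x∉ y∉ x∈A y∉A
  -- The roles of `x` and `y` are exchanged; flips at distinct elements commute.
  ... | no x∉A | yes y∈A =
    subst (λ B → ¬ T (core z i f B)) (updateAt-commutes y x (λ { refl → x∉A y∈A }) A) (swap y x y∉ x∉ y∈A x∉A)
  ... | yes x∈A | yes y∈A = contradiction (trans ([]=⇒lookup x∈A) (sym ([]=⇒lookup y∈A))) Ax≢Ay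
  ... | no x∉A | no y∉A = contradiction (trans (out x∉A) (sym (out y∉A))) Ax≢Ay
    where
    out : ∀ {v} → v ∉ A → lookup A v ≡ false
    out {v} v∉A = ¬-not (v∉A ∘ lookup⇒[]= v A)

count-empty : (f : Subset n → Bool) → (∀ A → ¬ T (f A)) → count f ≡ 0
count-empty {n} f empty = trans (sumₛ-cong (λ A → 𝟙≡0 (f A) (empty A))) (trans (sumₛ-const n 0) (*-zeroʳ (2 ^ n)))

-- After k rounds the core is empty: from a member, k swaps would produce a chain of k + 1 sets.
-- Such a walk touches at most 2k elements, hence `z = k + k`.
diagonal-count : ∀ k (f : Subset n → Bool) → TraceFree k k f →
  count f * (n ∸ (k + k)) ≤ k * (2 ^ n * (suc (k + k) + suc (k + k)))
diagonal-count {n} k f free = ≤-trans (core-count z k f)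
  (+-monoˡ-≤ (k * (2 ^ n * (suc z + suc z))) (≤-reflexive (cong (_* (n ∸ z)) (count-empty (core z k f) core-empty))))
  where
  z = k + k
  core-empty : ∀ A → ¬ T (core z k f A)
  core-empty A t = core-walk z k 0 f {⊥} {⊥} (subst (λ k → TraceFree k k f) (sym (+-identityʳ k)) free)
    (≤-reflexive (cong₂ _+_ (+-identityʳ k) (+-identityʳ k))) (∣⊥∣≡0 n) (≤-reflexive (∣⊥∣≡0 n))
    (λ x∈⊥ → contradiction x∈⊥ ∉⊥) (base (core-⊆ z k f t)) t

-- Erdős's theorem

Chain-truncate : {f : Subset n → Bool} {R : Rel (Subset n) 0ℓ} → ∀ {k m A} →
  suc k ≤ m → Chain f R m A → ∃ λ B → Chain f R (suc k) B
Chain-truncate {k = zero} _ c = _ , base (Chain-head c)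
Chain-truncate {k = suc k} (s≤s ()) (base _)
Chain-truncate {k = suc k} {m = suc m} k<m (step c r t) with m≤n⇒m<n∨m≡n k<m
... | inj₁ (s≤s k<m′) = Chain-truncate k<m′ c
... | inj₂ refl = _ , step c r t

-- Symmetric chain decomposition of the Boolean lattice; each chain lists its sets from largest to smallest.
extend : List⁺ (Subset n) → List (List⁺ (Subset (suc n)))
extend (A ∷ [])     = ((inside ∷ A) ∷ (outside ∷ A) ∷ []) ∷ []
extend (A ∷ B ∷ Bs) = ((inside ∷ A) ∷ map (outside ∷_) (A ∷ B ∷ Bs)) ∷ ((inside ∷ B) ∷ map (inside ∷_) Bs) ∷ []

chains : ∀ n → List (List⁺ (Subset n))
chains zero    = ([] ∷ []) ∷ []
chains (suc n) = concatMap extend (chains n)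

countₗ : (Subset n → Bool) → List (Subset n) → ℕ
countₗ f = List.sum ∘ map (𝟙 ∘ f)

total : (Subset n → Bool) → List (List⁺ (Subset n)) → ℕ
total f = List.sum ∘ map (countₗ f ∘ toList)

total-++ : (f : Subset n → Bool) → ∀ cs ds → total f (cs ++ ds) ≡ total f cs + total f ds
total-++ f cs ds = trans (cong List.sum (map-++ (countₗ f ∘ toList) cs ds)) (sum-++ (map (countₗ f ∘ toList) cs) _)

countₗ-map : ∀ {m} (f : Subset n → Bool) (g : Subset m → Subset n) As → countₗ f (map g As) ≡ countₗ (f ∘ g) As
countₗ-map f g As = cong List.sum (sym (map-∘ As))

-- The first new chain takes the whole `outside` copy and the top of the `inside` copy; the second,
-- if any, takes what remains.
total-extend : (f : Subset (suc n) → Bool) → ∀ c →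
  total f (extend c) ≡ countₗ (f ∘ (outside ∷_)) (toList c) + countₗ (f ∘ (inside ∷_)) (toList c)
total-extend f (A ∷ []) = single (𝟙 (f (inside ∷ A))) (𝟙 (f (outside ∷ A)))
  where
  single : ∀ a b → a + (b + 0) + 0 ≡ (b + 0) + (a + 0)
  single = solve-∀
total-extend f (A ∷ B ∷ Bs) = trans
  (cong₂ (λ x y → 𝟙 (f (inside ∷ A)) + x + (𝟙 (f (inside ∷ B)) + y + 0))
    (countₗ-map f (outside ∷_) (A ∷ B ∷ Bs)) (countₗ-map f (inside ∷_) Bs))
  (rearrange (𝟙 (f (inside ∷ A))) (countₗ (f ∘ (outside ∷_)) (A ∷ B ∷ Bs)) (𝟙 (f (inside ∷ B))) _)
  where
  rearrange : ∀ a b c d → (a + b) + (c + d + 0) ≡ b + (a + (c + d))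
  rearrange = solve-∀

total-concatMap-extend : (f : Subset (suc n) → Bool) → ∀ cs →
  total f (concatMap extend cs) ≡ total (f ∘ (outside ∷_)) cs + total (f ∘ (inside ∷_)) cs
total-concatMap-extend f []       = refl
total-concatMap-extend f (c ∷ cs) = trans (total-++ f (extend c) _)
  (trans (cong₂ _+_ (total-extend f c) (total-concatMap-extend f cs))
    (+-interchange (countₗ (f ∘ (outside ∷_)) (toList c)) _ _ _))

-- The partition property of the decomposition, phrased through counts.
total-chains : ∀ n (f : Subset n → Bool) → total f (chains n) ≡ count f
total-chains zero    f = trans (+-identityʳ _) (+-identityʳ _)
total-chains (suc n) f = trans (total-concatMap-extend f (chains n))
  (cong₂ _+_ (total-chains n (f ∘ (outside ∷_))) (total-chains n (f ∘ (inside ∷_))))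

Covers : Rel (Subset n) 0ℓ
Covers A B = A ⊃ B × ∣ A ∣ ≡ suc ∣ B ∣

inside-Covers-outside : (A : Subset n) → Covers (inside ∷ A) (outside ∷ A)
inside-Covers-outside A = out⊂in (λ x∈A → x∈A) , refl

Covers-outside : {A B : Subset n} → Covers A B → Covers (outside ∷ A) (outside ∷ B)
Covers-outside (A⊃B , eq) = out⊂ A⊃B , eq

Covers-inside : {A B : Subset n} → Covers A B → Covers (inside ∷ A) (inside ∷ B)
Covers-inside (A⊃B , eq) = in⊂in A⊃B , cong suc eq

-- The smallest set has `∣ A ∣ ∸ length As` elements, so the equation says that the smallest and
-- largest sizes add up to n.
Symmetric : List⁺ (Subset n) → Set
Symmetric {n} (A ∷ As) = Linked Covers (A ∷ As) × ∣ A ∣ + ∣ A ∣ ≡ n + length As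

-- The first new chain gains a set and its top gains an element; the second, when present, loses a
-- set and its top keeps the size of `A`. Both shifts fit n + 1.
extend-symmetric : ∀ {c : List⁺ (Subset n)} → Symmetric c → All Symmetric (extend c)
extend-symmetric {n} {A ∷ []} (_ , eq) =
  (inside-Covers-outside A ∷ [-] , trans (cong suc (+-suc ∣ A ∣ ∣ A ∣)) (trans (cong (2 +_) eq) (lengths n))) ∷ []
  where
  lengths : ∀ n → 2 + (n + 0) ≡ suc n + 1
  lengths = solve-∀
extend-symmetric {n} {A ∷ B ∷ Bs} ((A⋗B , ∣A∣≡1+∣B∣) ∷ linked , eq) =
  ( inside-Covers-outside A ∷ Linked.map⁺ (Linked.map Covers-outside ((A⋗B , ∣A∣≡1+∣B∣) ∷ linked))
  , trans (cong suc (+-suc ∣ A ∣ ∣ A ∣)) (trans (cong (2 +_) eq) (trans (lengths n (length Bs))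
      (cong (λ l → suc n + (2 + l)) (sym (length-map (outside ∷_) Bs))))))
  ∷ ( Linked.map⁺ (Linked.map Covers-inside linked)
    , trans (cong₂ _+_ (sym ∣A∣≡1+∣B∣) (sym ∣A∣≡1+∣B∣)) (trans eq (trans (+-suc n (length Bs))
        (cong (suc n +_) (sym (length-map (inside ∷_) Bs))))))
  ∷ []
  where
  lengths : ∀ n l → 2 + (n + suc l) ≡ suc n + (2 + l)
  lengths = solve-∀

chains-symmetric : ∀ n → All Symmetric (chains n)
chains-symmetric zero    = ([-] , refl) ∷ []
chains-symmetric (suc n) = All.concat⁺ (All.map⁺ (All.map extend-symmetric (chains-symmetric n)))

count-level : ∀ n s → count {n} (λ A → ∣ A ∣ ≡ᵇ s) ≡ n C s
count-level zero    zero    = refl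
count-level zero    (suc s) = refl
count-level (suc n) zero    = begin
  count {n} (λ A → ∣ A ∣ ≡ᵇ 0) + sumₛ {n} (λ _ → 0)
    ≡⟨ cong₂ _+_ (count-level n 0) (trans (sumₛ-const n 0) (*-zeroʳ (2 ^ n))) ⟩
  n C 0 + 0                                          ≡⟨ +-identityʳ _ ⟩
  n C 0                                              ≡⟨ trans (nC0≡1 n) (sym (nC0≡1 (suc n))) ⟩
  suc n C 0                                          ∎
  where
  open ≡-Reasoning
  nC0≡1 : ∀ n → n C 0 ≡ 1
  nC0≡1 n = trans (nCk≡nC[n∸k] {0} {n} z≤n) (nCn≡1 n)
count-level (suc n) (suc s) = begin
  count {n} (λ A → ∣ A ∣ ≡ᵇ suc s) + count {n} (λ A → ∣ A ∣ ≡ᵇ s)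
    ≡⟨ cong₂ _+_ (count-level n (suc s)) (count-level n s) ⟩
  n C suc s + n C s                                               ≡⟨ +-comm (n C suc s) (n C s) ⟩
  n C s + n C suc s                                               ≡⟨ nCk+nC[k+1]≡[n+1]C[k+1] n s ⟩
  suc n C suc s                                                   ∎
  where open ≡-Reasoning

-- Sizes fall by exactly one along the list, so level s is met j steps below the top.
linked-hits-level : ∀ s j {A : Subset n} {As} → Linked Covers (A ∷ As) → ∣ A ∣ ≡ s + j → j ≤ length As →
  1 ≤ countₗ (λ B → ∣ B ∣ ≡ᵇ s) (A ∷ As)
linked-hits-level s zero {A} {As} _ ∣A∣≡s+0 _ =
  m≤n⇒m≤n+o (countₗ (λ B → ∣ B ∣ ≡ᵇ s) As) (1≤𝟙 (≡⇒≡ᵇ ∣ A ∣ s (trans ∣A∣≡s+0 (+-identityʳ s))))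
  where
  1≤𝟙 : ∀ {b} → T b → 1 ≤ 𝟙 b
  1≤𝟙 {true} _ = ≤-refl
linked-hits-level s (suc j) {A} {B ∷ Bs} ((_ , ∣A∣≡1+∣B∣) ∷ linked) ∣A∣≡s+1+j (s≤s j≤) =
  m≤n⇒m≤o+n (𝟙 (∣ A ∣ ≡ᵇ s)) (linked-hits-level s j linked ∣B∣≡s+j j≤)
  where
  ∣B∣≡s+j : ∣ B ∣ ≡ s + j
  ∣B∣≡s+j = suc-injective (trans (sym ∣A∣≡1+∣B∣) (trans ∣A∣≡s+1+j (+-suc s j)))

-- Halving with a slack of one, to absorb the rounding of n / 2 for odd n.
m+m≤1+n+n⇒m≤n : ∀ m n → m + m ≤ suc (n + n) → m ≤ n
m+m≤1+n+n⇒m≤n zero    n       _ = z≤n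
m+m≤1+n+n⇒m≤n (suc m) zero    (s≤s m+1+m≤0) = contradiction (≤-trans (≤-reflexive (sym (+-suc m m))) m+1+m≤0) λ ()
m+m≤1+n+n⇒m≤n (suc m) (suc n) (s≤s m+1+m≤) =
  s≤s (m+m≤1+n+n⇒m≤n m n (s≤s⁻¹ (≤-trans (≤-reflexive (sym (+-suc m m))) (≤-trans m+1+m≤ (≤-reflexive (cong suc (+-suc n n)))))))

half-bounds : ∀ n → (n / 2 + n / 2 ≤ n) × (n ≤ suc (n / 2 + n / 2))
half-bounds n =
    ≤-trans (≤-reflexive (sym (p*2≡p+p (n / 2)))) (m/n*n≤m n 2)
  , ≤-trans (≤-reflexive (m≡m%n+[m/n]*n n 2)) (+-mono-≤ (s≤s⁻¹ (m%n<n n 2)) (≤-reflexive (p*2≡p+p (n / 2))))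

symmetric-hits-middle : ∀ {c : List⁺ (Subset n)} → Symmetric c → 1 ≤ countₗ (λ B → ∣ B ∣ ≡ᵇ n / 2) (toList c)
symmetric-hits-middle {n} {A ∷ As} (linked , eq) =
  linked-hits-level s (∣ A ∣ ∸ s) linked (sym (m+[n∸m]≡n s≤∣A∣)) (m≤n+o⇒m∸n≤o ∣ A ∣ s ∣A∣≤s+r)
  where
  s = n / 2
  r = length As
  s≤∣A∣ : s ≤ ∣ A ∣
  s≤∣A∣ = m+m≤1+n+n⇒m≤n s ∣ A ∣ (m≤n⇒m≤1+n (≤-trans (proj₁ (half-bounds n)) (≤-trans (m≤m+n n r) (≤-reflexive (sym eq)))))
  ∣A∣≤s+r : ∣ A ∣ ≤ s + r
  ∣A∣≤s+r = m+m≤1+n+n⇒m≤n ∣ A ∣ (s + r) (begin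
    ∣ A ∣ + ∣ A ∣                ≡⟨ eq ⟩
    n + r                        ≤⟨ +-mono-≤ (proj₂ (half-bounds n)) (m≤m+n r r) ⟩
    suc (s + s) + (r + r)        ≡⟨ cong suc (+-interchange s s r r) ⟩
    suc ((s + r) + (s + r))      ∎)
    where open ≤-Reasoning

-- The list decreases while `Chain` ascends, so the first member of `f` in the list becomes the top.
-- Returning `A ∈ₗ As` allows comparison with still larger sets.
chain-of-count : (f : Subset n → Bool) {R : Rel (Subset n) 0ℓ} → ∀ {As} → AllPairs (λ A B → R B A) As →
  ∀ m → countₗ f As ≡ suc m → ∃ λ A → A ∈ₗ As × Chain f R (suc m) A
chain-of-count f {As = A ∷ As} (A>As ∷ decreasing) m eq with f A in fA≡
chain-of-count f {As = A ∷ As} (A>As ∷ decreasing) m eq | false with chain-of-count f decreasing m eq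
... | B , B∈As , c = B , there B∈As , c
chain-of-count f {As = A ∷ As} (A>As ∷ decreasing) zero eq | true = A , here refl , base (subst T (sym fA≡) _)
chain-of-count f {As = A ∷ As} (A>As ∷ decreasing) (suc m) eq | true with chain-of-count f decreasing m (suc-injective eq)
... | B , B∈As , c = A , here refl , step c (All.lookup A>As B∈As) (subst T (sym fA≡) _)

sum-map-≤ : ∀ {X : Set} (w : X → ℕ) k {xs} → All (λ x → w x ≤ k) xs → List.sum (map w xs) ≤ length xs * k
sum-map-≤ w k []         = z≤n
sum-map-≤ w k (wx≤k ∷ p) = +-mono-≤ wx≤k (sum-map-≤ w k p)

length≤sum-map : ∀ {X : Set} (w : X → ℕ) {xs} → All (λ x → 1 ≤ w x) xs → length xs ≤ List.sum (map w xs)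
length≤sum-map w []         = z≤n
length≤sum-map w (1≤wx ∷ p) = +-mono-≤ 1≤wx (length≤sum-map w p)

-- Each chain meets the middle level, and the total over all chains is the size of that level.
length-chains : ∀ n → length (chains n) ≤ central n
length-chains n = begin
  length (chains n)                         ≤⟨ length≤sum-map _ (All.map symmetric-hits-middle (chains-symmetric n)) ⟩
  total (λ A → ∣ A ∣ ≡ᵇ n / 2) (chains n)   ≡⟨ total-chains n _ ⟩
  count {n} (λ A → ∣ A ∣ ≡ᵇ n / 2)          ≡⟨ count-level n (n / 2) ⟩
  central n                                 ∎
  where open ≤-Reasoning

-- Each chain of the decomposition contains at most k members of `f`, since k + 1 of them would form
-- a forbidden chain with nothing deleted.
erdős : ∀ k (f : Subset n → Bool) → TraceFree 0 k f → count f ≤ k * central n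
erdős {n} k f free = begin
  count f                   ≡⟨ total-chains n f ⟨
  total f (chains n)        ≤⟨ sum-map-≤ (countₗ f ∘ toList) k (All.map (λ {c} → few c) (chains-symmetric n)) ⟩
  length (chains n) * k     ≤⟨ *-monoˡ-≤ k (length-chains n) ⟩
  central n * k             ≡⟨ *-comm (central n) k ⟩
  k * central n             ∎
  where
  open ≤-Reasoning
  below : ∀ {A B : Subset n} → A ⊂ B → Below ⊥ (∁ ⊥) A B
  below (A⊆B , y , y∈B , y∉A) = (λ _ → A⊆B) , y , x∉p⇒x∈∁p ∉⊥ , y∉A , y∈B
  few : ∀ c → Symmetric c → countₗ f (toList c) ≤ k
  few (A ∷ As) (linked , _) with countₗ f (A ∷ As) in eq
  ... | zero = z≤n
  ... | suc m with m <? k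
  ... | yes m<k = m<k
  ... | no m≮k with chain-of-count f
                      (Linked.Linked⇒AllPairs (λ A⊃B B⊃C → ⊂-trans B⊃C A⊃B) (Linked.map proj₁ linked)) m eq
  ... | B , _ , c = contradiction (Chain-weaken below (proj₂ (Chain-truncate (s≤s (≮⇒≥ m≮k)) c))) (free ⊥ (∣⊥∣≡0 n))

-- The asymptotic bound

-- The o(1) term with denominators cleared: for each m the ratio to `central n` is eventually at
-- most d + 1/(m+1). The parameter `d` stands for k - l.
AsymptoticBound : (d l k : ℕ) → Set
AsymptoticBound d l k = ∀ m → ∃ λ N → ∀ n → N ≤ n → (f : Subset n → Bool) → TraceFree l k f →
  suc m * count f ≤ (d * suc m + 1) * central n

asymptotic-erdős : ∀ k → AsymptoticBound k 0 k
asymptotic-erdős k m = 0 , λ n _ f free → begin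
  suc m * count f                 ≤⟨ *-monoʳ-≤ (suc m) (erdős k f free) ⟩
  suc m * (k * central n)         ≡⟨ regroup (suc m) k (central n) ⟩
  k * suc m * central n           ≤⟨ *-monoˡ-≤ (central n) (m≤m+n (k * suc m) 1) ⟩
  (k * suc m + 1) * central n     ∎
  where
  open ≤-Reasoning
  regroup : ∀ m k c → m * (k * c) ≡ k * m * c
  regroup = solve-∀

asymptotic-diagonal : ∀ k → AsymptoticBound 0 k k
-- The summand `z + z` ensures n ≤ 2(n - z); the rest is the threshold for `q`, which collects the
-- factors m + 1, 2 and `K`.
asymptotic-diagonal k m = z + z + suc (12 * (q * q)) , bound
  where
  z = k + k
  K = k * (suc z + suc z)
  q = suc m * (2 * K)
  bound : ∀ n → z + z + suc (12 * (q * q)) ≤ n → (f : Subset n → Bool) → TraceFree k k f →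
    suc m * count f ≤ (0 * suc m + 1) * central n
  bound n N≤n f free = *-cancelˡ-≤ n (begin
    n * (suc m * count f)                                    ≤⟨ *-monoˡ-≤ (suc m * count f) n≤2[n∸z] ⟩
    ((n ∸ z) + (n ∸ z)) * (suc m * count f)                  ≡⟨ regroup₁ (n ∸ z) (suc m) (count f) ⟩
    suc m * (2 * (count f * (n ∸ z)))
      ≤⟨ *-monoʳ-≤ (suc m) (*-monoʳ-≤ 2 (diagonal-count k f free)) ⟩
    suc m * (2 * (k * (2 ^ n * (suc z + suc z))))            ≡⟨ regroup₂ (suc m) k (2 ^ n) (suc z + suc z) ⟩
    q * 2 ^ n                                                ≤⟨ q*2^n≤n*central q n (m+n≤o⇒n≤o (z + z) N≤n) ⟩
    n * central n                                            ≡⟨ cong (n *_) (*-identityˡ (central n)) ⟨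
    n * ((0 * suc m + 1) * central n)                        ∎)
    where
    open ≤-Reasoning
    instance
      n≢0 : NonZero n
      n≢0 = >-nonZero (≤-trans (s≤s z≤n) (m+n≤o⇒n≤o (z + z) N≤n))
    n≤2[n∸z] : n ≤ (n ∸ z) + (n ∸ z)
    n≤2[n∸z] = begin
      n                      ≡⟨ m∸n+n≡m z≤n′ ⟨
      (n ∸ z) + z            ≤⟨ +-monoʳ-≤ (n ∸ z) (m+n≤o⇒m≤o∸n z z+z≤n) ⟩
      (n ∸ z) + (n ∸ z)      ∎
      where
      z+z≤n : z + z ≤ n
      z+z≤n = m+n≤o⇒m≤o (z + z) N≤n
      z≤n′ : z ≤ n
      z≤n′ = m+n≤o⇒m≤o z z+z≤n
    regroup₁ : ∀ w m c → (w + w) * (m * c) ≡ m * (2 * (c * w))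
    regroup₁ = solve-∀
    regroup₂ : ∀ m k x y → m * (2 * (k * (x * y))) ≡ m * (2 * (k * y)) * x
    regroup₂ = solve-∀

-- The induction step doubles the precision, to absorb the error in central (n + 1) ≈ 2 central n.
asymptotic-step : ∀ d l k → AsymptoticBound (suc (suc d)) l (suc k) → AsymptoticBound d (suc l) k →
  AsymptoticBound (suc d) (suc l) (suc k)
asymptotic-step d l k traces pairs m with traces (m + suc m) | pairs (m + suc m)
-- Here `suc (m + suc m)` is 2M. Averaging the constants d + 2 and d gives d + 1: the two numerators
-- add up to 2E. The threshold secures E ≤ n + 1, which pays for the factor (n+2)/(n+1).
... | N₁ , trace-bound | N₂ , pairs-bound = suc (N₁ + N₂ + E) , bound
  where
  M = suc m
  E = suc d * (2 * M) + 1
  bound : ∀ n → suc (N₁ + N₂ + E) ≤ n → (f : Subset n → Bool) → TraceFree (suc l) (suc k) f →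
    M * count f ≤ (suc d * M + 1) * central n
  bound (suc n) (s≤s N≤n) f free = *-cancelˡ-≤ (4 * suc n) (begin
    4 * suc n * (M * count f)
      ≡⟨ cong (λ c → 4 * suc n * (M * c)) (count-trace-pairs f) ⟩
    4 * suc n * (M * (a + b))                                    ≡⟨ regroup₁ (suc n) M a b ⟩
    2 * suc n * ((M + M) * a + (M + M) * b)                      ≤⟨ *-monoʳ-≤ (2 * suc n) (+-mono-≤ a-bound b-bound) ⟩
    2 * suc n * ((suc (suc d) * (M + M) + 1) * c + (d * (M + M) + 1) * c)
                                                                 ≡⟨ regroup₂ (suc n) d M c ⟩
    2 * E * (2 * (suc n * c))
      ≤⟨ *-monoʳ-≤ (2 * E) (2*[1+n]*central≤[2+n]*central n) ⟩
    2 * E * (suc (suc n) * c′)                                   ≡⟨ regroup₃ E n c′ ⟩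
    2 * (suc n * E + E) * c′
      ≤⟨ *-monoˡ-≤ c′ (*-monoʳ-≤ 2 (+-monoʳ-≤ (suc n * E) E≤1+n)) ⟩
    2 * (suc n * E + suc n) * c′                                 ≡⟨ regroup₄ (suc n) d M c′ ⟩
    4 * suc n * ((suc d * M + 1) * c′)                           ∎)
    where
    open ≤-Reasoning
    a = count (traceₛ f)
    b = count (pairsₛ f)
    c = central n
    c′ = central (suc n)
    E≤1+n : E ≤ suc n
    E≤1+n = m≤n⇒m≤1+n (m+n≤o⇒n≤o (N₁ + N₂) N≤n)
    a-bound : (M + M) * a ≤ (suc (suc d) * (M + M) + 1) * c
    a-bound = trace-bound n (m+n≤o⇒m≤o N₁ (m+n≤o⇒m≤o (N₁ + N₂) N≤n)) (traceₛ f) (trace-free {f = f} free)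
    b-bound : (M + M) * b ≤ (d * (M + M) + 1) * c
    b-bound = pairs-bound n (m+n≤o⇒n≤o N₁ (m+n≤o⇒m≤o (N₁ + N₂) N≤n)) (pairsₛ f) (pairs-free {f = f} free)
    regroup₁ : ∀ n M a b → 4 * n * (M * (a + b)) ≡ 2 * n * ((M + M) * a + (M + M) * b)
    regroup₁ = solve-∀
    regroup₂ : ∀ n d M c → 2 * n * ((suc (suc d) * (M + M) + 1) * c + (d * (M + M) + 1) * c)
                         ≡ 2 * (suc d * (2 * M) + 1) * (2 * (n * c))
    regroup₂ = solve-∀
    regroup₃ : ∀ E n c → 2 * E * (suc (suc n) * c) ≡ 2 * (suc n * E + E) * c
    regroup₃ = solve-∀
    regroup₄ : ∀ n d M c → 2 * (n * (suc d * (2 * M) + 1) + n) * c ≡ 4 * n * ((suc d * M + 1) * c)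
    regroup₄ = solve-∀

-- Outer induction on l, inner on d = k - l: from (l + 1 , d + 1) the traces lead to (l , d + 2) and
-- the pairs to (l + 1 , d).
asymptotic-bound : ∀ l d → AsymptoticBound d l (d + l)
asymptotic-bound zero    d       = subst (AsymptoticBound d 0) (sym (+-identityʳ d)) (asymptotic-erdős d)
asymptotic-bound (suc l) zero    = asymptotic-diagonal (suc l)
asymptotic-bound (suc l) (suc d) = asymptotic-step d l (d + suc l)
  (subst (AsymptoticBound (suc (suc d)) l) (cong suc (sym (+-suc d l))) (asymptotic-bound l (suc (suc d))))
  (asymptotic-bound (suc l) d)

-- From duplicate-free lists to Boolean predicates

_∈ₗ?_ : (A : Subset n) (𝓕 : List (Subset n)) → Dec (A ∈ₗ 𝓕)
_∈ₗ?_ = Data.List.Membership.DecPropositional._∈?_ (≡-dec _≟ᵇ_)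

-- By uniqueness each further head is a subset not counted before, so the count grows strictly.
length≤count : {𝓕 : List (Subset n)} → Unique 𝓕 → length 𝓕 ≤ count (λ A → ⌊ A ∈ₗ? 𝓕 ⌋)
length≤count []                          = z≤n
length≤count {𝓕 = A ∷ 𝓕} (A≢ ∷ unique) = ≤-<-trans (length≤count unique)
  (sumₛ-mono-< (λ B → 𝟙-mono (fromWitness ∘ there ∘ toWitness)) A
    (𝟙-< (λ t → All.lookup A≢ (toWitness t) refl) (fromWitness (here refl))))
  where
  𝟙-mono : ∀ {a b} → (T a → T b) → 𝟙 a ≤ 𝟙 b
  𝟙-mono {false}         _ = z≤n
  𝟙-mono {true}  {true}  _ = ≤-refl
  𝟙-mono {true}  {false} h = contradiction _ h
  𝟙-< : ∀ {a b} → ¬ T a → T b → 𝟙 a < 𝟙 b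
  𝟙-< {true}         ¬t _ = contradiction _ ¬t
  𝟙-< {false} {true} _  _ = ≤-refl

Below⇒⊂-trace : {D A B : Subset n} → Below D (∁ D) A B → A ∩ ∁ D ⊂ B ∩ ∁ D
Below⇒⊂-trace {D = D} {A} {B} (A⊆B , y , y∈∁D , y∉A , y∈B) =
  (λ x∈ → let x∈A , x∈∁D = x∈p∩q⁻ A (∁ D) x∈ in x∈p∩q⁺ (A⊆B (x∈∁p⇒x∉p x∈∁D) x∈A , x∈∁D))
  , y , x∈p∩q⁺ (y∈B , y∈∁D) , y∉A ∘ proj₁ ∘ x∈p∩q⁻ A (∁ D)

module _ (𝓕 : List (Subset n)) (D : Subset n) where
  private
    tr : Subset n → Subset n
    tr A = A ∩ ∁ D
    _≺_ : Subset n → Subset n → Set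
    _≺_ = Below D (∁ D)

  -- The chain is consumed from its top, so `cs` accumulates the larger traces already passed.
  chain-in-trace : ∀ {k A} → Chain (λ B → ⌊ B ∈ₗ? 𝓕 ⌋) _≺_ k A → ∀ {cs} → Linked _⊂_ (tr A ∷ cs) →
    All (_∈ₗ trace 𝓕 (∁ D)) cs → ∃ λ ds → IsChain (k + length cs) ds × All (_∈ₗ trace 𝓕 (∁ D)) ds
  chain-in-trace (base t) {cs} linked all = _ , (refl , linked) , ∈-map⁺ tr (toWitness t) ∷ all
  chain-in-trace {suc k} {A} (step c A≺B t) {cs} linked all
    with chain-in-trace c (Below⇒⊂-trace A≺B ∷ linked) (∈-map⁺ tr (toWitness t) ∷ all)
  ... | ds , (length≡ , linked′) , all′ = ds , (trans length≡ (+-suc k (length cs)) , linked′) , all′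

TraceSperner⇒TraceFree : ∀ l k (𝓕 : List (Subset n)) → TraceSperner (n ∸ l) k 𝓕 → TraceFree l k (λ A → ⌊ A ∈ₗ? 𝓕 ⌋)
TraceSperner⇒TraceFree {n} l k 𝓕 sperner D ∣D∣≡l c with chain-in-trace 𝓕 D c [-] []
... | ds , (length≡ , linked) , all =
  sperner (∁ D) (trans (∣∁p∣≡n∸∣p∣ D) (cong (n ∸_) ∣D∣≡l)) (ds , (trans length≡ (+-identityʳ (suc k)) , linked) , all)

theorem1p2 : (k l' : ℕ) → 1 ≤ l' → l' < k →
    (m : ℕ) → ∃ λ (N : ℕ) → (n : ℕ) → N ≤ n →
    (𝓕 : List (Subset n)) → Unique 𝓕 → TraceSperner (n ∸ l') k 𝓕 →
    suc m * length 𝓕 ≤ ((k ∸ l') * suc m + 1) * (n C (n / 2))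
theorem1p2 k l' _ l'<k m
  with subst (AsymptoticBound (k ∸ l') l') (m∸n+n≡m (<⇒≤ l'<k)) (asymptotic-bound l' (k ∸ l')) m
... | N , bound = N , λ n N≤n 𝓕 unique sperner →
  ≤-trans (*-monoʳ-≤ (suc m) (length≤count unique))
    (bound n N≤n (λ A → ⌊ A ∈ₗ? 𝓕 ⌋) (TraceSperner⇒TraceFree l' k 𝓕 sperner))
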